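{- Let $n\ge 1$ and let $\mathbf d=(d_1<\dots<d_s)$ be a rank vector with $1\le d_1$ and $d_s\le n$. Then the set of Bruhat polytopes of rank $\mathbf d$, $\{Q^{\mathbf d}_{u,v} : [u,v]\in \operatorname{BI}(\mathbf d,n)\}$, is equal to the set of twisted Bruhat polytopes of rank $\mathbf d$, $\{\widetilde Q^{\mathbf d}_{u,v} : [u,v]\in \widetilde{\operatorname{BI}}(\mathbf d,n)\}$.
   Context: $\operatorname{Sym}_n$ is the symmetric group on $[n]=\{1,\dots,n\}$, equipped with the (strong) Bruhat order $\le$; for $u\le v$, $[u,v]=\{x: u\le x\le v\}$. Permutations act on $\mathbb R^n$ by permuting coordinates: $(x\cdot y)_j=y_{x^{ -1}(j)}$. For $B\subseteq[n]$ let $e_B=\sum_{i\in B}e_i$, and let $e_{\mathbf d}=e_{[d_1]}+\dots+e_{[d_s]}$, where $[d]=\{1,\dots,d\}$. Untwisted convention: let $f:[n]\to\{0,\dots,s\}$, $f(j)=\#\{k : d_k\ge n+1-j\}$, and $\Phi(x)=(f(x(1)),\dots,f(x(n)))\in\mathbb R^n$. $\operatorname{BI}(\mathbf d,n)$ is the set of intervals $[u,v]$ with $u\le v$ such that $v$ is the Bruhat-minimal element of $\{y\in\operatorname{Sym}_n:\Phi(y)=\Phi(v)\}$; for such an interval the Bruhat polytope is $Q^{\mathbf d}_{u,v}=\operatorname{conv}\{\Phi(x): x\in[u,v]\}$. Twisted convention: $\widetilde{\operatorname{BI}}(\mathbf d,n)$ is the set of intervals $[u,v]$ with $u\le v$ such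 that $v$ is the Bruhat-minimal element of $\{y\in \operatorname{Sym}_n: y\cdot e_{\mathbf d}=v\cdot e_{\mathbf d}\}$; for such an interval the twisted Bruhat polytope is $\widetilde Q^{\mathbf d}_{u,v}=\operatorname{conv}\{x\cdot e_{\mathbf d}: x\in[u,v]\}$. -}

module Defs where

open import Data.Nat using (ℕ; zero; suc; _+_; _≤_; _<_)
open import Data.Nat.Properties using (_≤?_; _<?_)
open import Data.Fin using (Fin; toℕ)
import Data.Fin as F
open import Data.Fin.Permutation using (Permutation′; _⟨$⟩ʳ_; _⟨$⟩ˡ_)
open import Data.Fin.Permutation.Components using (transpose)
open import Data.Bool using (Bool; true; false)
open import Data.List using (List; []; _∷_; foldr; map)
open import Data.List.Relation.Unary.All using (All)
open import Data.Product using (Σ; _×_; _,_; ∃)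
open import Data.Integer using (+_)
open import Data.Rational using (ℚ; _/_; 0ℚ; 1ℚ) renaming (_+_ to _+ℚ_; _*_ to _*ℚ_; _≤_ to _≤ℚ_)
open import Relation.Binary.PropositionalEquality using (_≡_)
open import Relation.Nullary.Decidable using (does)
open import Function.Bundles using (_⇔_)

-- Sym_n : permutations of Fin n (Fin n stands for [n], index i ↦ i+1)
Perm : ℕ → Set
Perm n = Permutation′ n

_≈P_ : ∀ {n} → Perm n → Perm n → Set
_≈P_ {n} u v = (k : Fin n) → u ⟨$⟩ʳ k ≡ v ⟨$⟩ʳ k

-- covering-type step of the strong Bruhat order:
-- w = u ∘ (i j) with i < j and u(i) < u(j)  (right multiplication by a
-- transposition increasing the number of inversions)
BruhatStep : ∀ {n} → Perm n → Perm n → Set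
BruhatStep {n} u w = Σ (Fin n) λ i → Σ (Fin n) λ j →
  (toℕ i < toℕ j) × (toℕ (u ⟨$⟩ʳ i) < toℕ (u ⟨$⟩ʳ j)) ×
  ((k : Fin n) → w ⟨$⟩ʳ k ≡ u ⟨$⟩ʳ (transpose i j k))

data _≤B_ {n : ℕ} : Perm n → Perm n → Set where
  ≤B-refl : ∀ {u v} → u ≈P v → u ≤B v
  ≤B-step : ∀ {u w v} → u ≤B w → BruhatStep w v → u ≤B v

InInterval : ∀ {n} → Perm n → Perm n → Perm n → Set
InInterval u v x = (u ≤B x) × (x ≤B v)

count : ∀ {s} → (Fin s → Bool) → ℕ
count {zero} P = 0
count {suc s} P with P F.zero
... | true  = suc (count (λ k → P (F.suc k)))
... | false = count (λ k → P (F.suc k))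

IsRankVector : ∀ {s} → ℕ → (Fin s → ℕ) → Set
IsRankVector {s} n d =
  ((k : Fin s) → 1 ≤ d k) × ((k : Fin s) → d k ≤ n) ×
  ((k l : Fin s) → toℕ k < toℕ l → d k < d l)

-- f(j) = #{k : d_k ≥ n+1-j};  for the value x(j) = 1 + toℕ (x ⟨$⟩ʳ j)
-- the condition d_k ≥ n + 1 - (1 + toℕ (x j)) is  n ≤ d_k + toℕ (x j)
Φ : ∀ {s} (n : ℕ) → (Fin s → ℕ) → Perm n → Fin n → ℕ
Φ n d x j = count (λ k → does (n ≤? (d k + toℕ (x ⟨$⟩ʳ j))))

-- x · e_d, coordinate j = #{k : x^{-1}(j) ∈ [d_k]} = #{k : 1 + toℕ (x⁻¹ j) ≤ d_k}
twist : ∀ {s} (n : ℕ) → (Fin s → ℕ) → Perm n → Fin n → ℕ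
twist n d x j = count (λ k → does (toℕ (x ⟨$⟩ˡ j) <? d k))

InBI : ∀ {s} (n : ℕ) → (Fin s → ℕ) → Perm n → Perm n → Set
InBI {s} n d u v = (u ≤B v) ×
  ((y : Perm n) → ((j : Fin n) → Φ n d y j ≡ Φ n d v j) → v ≤B y)

InBI~ : ∀ {s} (n : ℕ) → (Fin s → ℕ) → Perm n → Perm n → Set
InBI~ {s} n d u v = (u ≤B v) ×
  ((y : Perm n) → ((j : Fin n) → twist n d y j ≡ twist n d v j) → v ≤B y)

Point : ℕ → Set
Point n = Fin n → ℚ

ℕtoℚ : ℕ → ℚ
ℕtoℚ m = (+ m) / 1

InConv : ∀ {n} → (Perm n → Set) → (Perm n → Fin n → ℕ) → Point n → Set
InConv {n} P g p = Σ (List (ℚ × Perm n)) λ c →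
  All (λ { (λ' , x) → (0ℚ ≤ℚ λ') × P x }) c ×
  (foldr (λ { (λ' , x) acc → λ' +ℚ acc }) 0ℚ c ≡ 1ℚ) ×
  ((j : Fin n) → p j ≡ foldr (λ { (λ' , x) acc → (λ' *ℚ ℕtoℚ (g x j)) +ℚ acc }) 0ℚ c)

InQ : ∀ {s} (n : ℕ) → (Fin s → ℕ) → Perm n → Perm n → Point n → Set
InQ n d u v = InConv (InInterval u v) (Φ n d)

InQ~ : ∀ {s} (n : ℕ) → (Fin s → ℕ) → Perm n → Perm n → Point n → Set
InQ~ n d u v = InConv (InInterval u v) (twist n d)

SamePolytope : ∀ {n} → (Point n → Set) → (Point n → Set) → Set
SamePolytope {n} A B = (p : Point n) → A p ⇔ B p

{-# OPTIONS --safe #-}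

-- Write w₀ for the longest element and W_J for the stabiliser of e_d, so that x · e_d
-- depends only on the coset x W_J.  Since Φ(x) = (w₀ x)⁻¹ · e_d and x ↦ (w₀ x)⁻¹ reverses
-- the Bruhat order, Bruhat polytopes are the twisted polytopes of intervals [u , v] with u
-- (instead of v) maximal in its coset.  To pass between the two kinds of intervals, start
-- with v minimal in its coset and multiply u and v by the same adjacent transpositions of
-- W_J, each increasing u, until u is maximal.  Each of them increases v as well, and by the
-- lifting property of the Bruhat order the set of cosets met by [u , v] does not change.
-- Conjugating with x ↦ w₀ x gives the converse passage.
module Submission where

open import Defs
open import Data.Nat using (ℕ; zero; suc; _≤_; _<_; _+_; _*_; _∸_; z≤n; s≤s)
open import Data.Nat.Properties
open import Data.Nat.Induction using (<-wellFounded)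
open import Data.Nat.Tactic.RingSolver using (solve-∀)
open import Data.Fin using (Fin; toℕ; opposite; inject₁)
import Data.Fin as F
open import Data.Fin.Properties using (toℕ-injective; toℕ<n; toℕ-inject₁; any?; punchInᵢ≢i;
  opposite-prop; opposite-involutive)
  renaming (_≟_ to _≟ᶠ_)
open import Data.Fin.Induction using (<-weakInduction)
open import Data.Fin.Permutation using (_⟨$⟩ʳ_; _⟨$⟩ˡ_; inverseˡ; inverseʳ; flip; reverse; _∘ₚ_)
  renaming (transpose to transposition)
open import Data.Fin.Permutation.Components using (transpose)
open import Data.Bool using (Bool; true; false)
open import Data.List using (foldr)
open import Data.List.Relation.Unary.All using (All; []; _∷_; reduce)
open import Data.Product using (Σ; _×_; _,_; proj₁; proj₂)
open import Data.Rational using () renaming (_+_ to _+ℚ_; _*_ to _*ℚ_)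
open import Data.Sum using (_⊎_; inj₁; inj₂)
open import Algebra.Properties.CommutativeMonoid.Sum +-0-commutativeMonoid
  using (sum; sum-remove; sum-cong-≗)
open import Function using (_∘_)
open import Function.Bundles using (mk⇔)
open import Induction.WellFounded using (Acc; acc)
open import Relation.Nullary using (¬_; Dec; yes; no; does; contradiction)
open import Relation.Nullary.Decidable using (dec-true; does-⇔; _×-dec_)
open import Relation.Binary.PropositionalEquality

-- Transpositions

-- The graph of a transposition, so that equations follow by matching on three cases. `left` and
-- `right` overlap only when `i` equals `j`, where they agree.
data Swapped {n} (i j : Fin n) : Fin n → Fin n → Set where
  left  : Swapped i j i j
  right : Swapped i j j i
  fixed : ∀ {k} → k ≢ i → k ≢ j → Swapped i j k k

swapped : ∀ {n} (i j k : Fin n) → Swapped i j k (transpose i j k)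
swapped i j k with k ≟ᶠ i
... | yes refl = left
... | no k≢i with k ≟ᶠ j
...   | yes refl = right
...   | no k≢j = fixed k≢i k≢j

Swapped-functional : ∀ {n} {i j k r r' : Fin n} → Swapped i j k r → Swapped i j k r' → r ≡ r'
Swapped-functional left        left        = refl
Swapped-functional left        right       = refl
Swapped-functional left        (fixed a b) = contradiction refl a
Swapped-functional right       left        = refl
Swapped-functional right       right       = refl
Swapped-functional right       (fixed a b) = contradiction refl b
Swapped-functional (fixed a b) left        = contradiction refl a
Swapped-functional (fixed a b) right       = contradiction refl b
Swapped-functional (fixed a b) (fixed _ _) = refl

Swapped-sym : ∀ {n} {i j k r : Fin n} → Swapped i j k r → Swapped i j r k
Swapped-sym left        = right
Swapped-sym right       = left
Swapped-sym (fixed a b) = fixed a b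

transpose-involutive : ∀ {n} (i j k : Fin n) → transpose i j (transpose i j k) ≡ k
transpose-involutive i j k =
  Swapped-functional (swapped i j (transpose i j k)) (Swapped-sym (swapped i j k))

transpose-left : ∀ {n} (i j : Fin n) → transpose i j i ≡ j
transpose-left i j = Swapped-functional (swapped i j i) left

transpose-right : ∀ {n} (i j : Fin n) → transpose i j j ≡ i
transpose-right i j = Swapped-functional (swapped i j j) right

transpose-fixed : ∀ {n} {i j k : Fin n} → k ≢ i → k ≢ j → transpose i j k ≡ k
transpose-fixed k≢i k≢j = Swapped-functional (swapped _ _ _) (fixed k≢i k≢j)

⟨$⟩ʳ-injective : ∀ {n} (π : Perm n) {i j} → π ⟨$⟩ʳ i ≡ π ⟨$⟩ʳ j → i ≡ j
⟨$⟩ʳ-injective π eq = trans (sym (inverseˡ π)) (trans (cong (π ⟨$⟩ˡ_) eq) (inverseˡ π))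

-- `π` maps the graph of one transposition into that of the other; its injectivity handles the fixed
-- points.
⟨$⟩ʳ-transpose : ∀ {n} (π : Perm n) (i j k : Fin n) →
  π ⟨$⟩ʳ transpose i j k ≡ transpose (π ⟨$⟩ʳ i) (π ⟨$⟩ʳ j) (π ⟨$⟩ʳ k)
⟨$⟩ʳ-transpose π i j k = Swapped-functional (image (swapped i j k)) (swapped _ _ _)
  where
  image : ∀ {k r} → Swapped i j k r → Swapped (π ⟨$⟩ʳ i) (π ⟨$⟩ʳ j) (π ⟨$⟩ʳ k) (π ⟨$⟩ʳ r)
  image left        = left
  image right       = right
  image (fixed a b) = fixed (a ∘ ⟨$⟩ʳ-injective π) (b ∘ ⟨$⟩ʳ-injective π)

Adjacent : ∀ {n} → Fin n → Fin n → Set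
Adjacent i j = toℕ j ≡ suc (toℕ i)

adjacent⇒< : ∀ {n} {i j : Fin n} → Adjacent i j → i F.< j
adjacent⇒< adj = ≤-reflexive (sym adj)

-- No position lies strictly between `i` and `j`, so they form the only pair whose order is
-- reversed.
transpose-adjacent-mono : ∀ {n} {i j : Fin n} → Adjacent i j → ∀ {p q} → p F.< q →
  ¬ (p ≡ i × q ≡ j) → transpose i j p F.< transpose i j q
transpose-adjacent-mono {i = i} {j} adj p<q ≢ij = go (swapped i j _) (swapped i j _) p<q ≢ij
  where
  i<j = adjacent⇒< adj
  go : ∀ {p q r t} → Swapped i j p r → Swapped i j q t → p F.< q → ¬ (p ≡ i × q ≡ j) → r F.< t
  go left        left        lt _ = contradiction lt (<-irrefl refl)
  go left        right       lt n = contradiction (refl , refl) n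
  go left        (fixed a b) lt _ =
    ≤∧≢⇒< (subst (_≤ _) (sym adj) lt) (b ∘ sym ∘ toℕ-injective)
  go right       left        lt _ = contradiction lt (<-asym i<j)
  go right       right       lt _ = contradiction lt (<-irrefl refl)
  go right       (fixed _ _) lt _ = <-trans i<j lt
  go (fixed _ _) left        lt _ = <-trans lt i<j
  go (fixed a _) right       lt _ =
    ≤∧≢⇒< (≤-pred (subst (_ ≤_) adj lt)) (a ∘ toℕ-injective)
  go (fixed _ _) (fixed _ _) lt _ = lt

-- Bruhat order

≤B-respʳ : ∀ {n} {u v w : Perm n} → u ≤B v → v ≈P w → u ≤B w
≤B-respʳ (≤B-refl e) e' = ≤B-refl λ k → trans (e k) (e' k)
≤B-respʳ (≤B-step le (i , j , i<j , lt , eq)) e' =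
  ≤B-step le (i , j , i<j , lt , λ k → trans (sym (e' k)) (eq k))

≤B-trans : ∀ {n} {u v w : Perm n} → u ≤B v → v ≤B w → u ≤B w
≤B-trans le (≤B-refl e)     = ≤B-respʳ le e
≤B-trans le (≤B-step le' s) = ≤B-step (≤B-trans le le') s

≤B-respˡ : ∀ {n} {u v w : Perm n} → u ≈P v → v ≤B w → u ≤B w
≤B-respˡ e = ≤B-trans (≤B-refl e)

BruhatStep⇒≤B : ∀ {n} (u w : Perm n) → BruhatStep u w → u ≤B w
BruhatStep⇒≤B u w st = ≤B-step {u = u} {u} {w} (≤B-refl λ _ → refl) st

swap : ∀ {n} → Fin n → Fin n → Perm n → Perm n
swap i j x = transposition i j ∘ₚ x

swap-involutive : ∀ {n} (i j : Fin n) (x : Perm n) → swap i j (swap i j x) ≈P x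
swap-involutive i j x k = cong (x ⟨$⟩ʳ_) (transpose-involutive i j k)

swap-cong : ∀ {n} (i j : Fin n) {x y : Perm n} → x ≈P y → swap i j x ≈P swap i j y
swap-cong i j e k = e (transpose i j k)

ascent-step : ∀ {n} {i j : Fin n} (x : Perm n) → i F.< j →
  x ⟨$⟩ʳ i F.< x ⟨$⟩ʳ j → BruhatStep x (swap i j x)
ascent-step {i = i} {j} x i<j lt = i , j , i<j , lt , λ _ → refl

≤B-ascent : ∀ {n} {i j : Fin n} (x : Perm n) → i F.< j →
  x ⟨$⟩ʳ i F.< x ⟨$⟩ʳ j → x ≤B swap i j x
≤B-ascent x i<j lt = BruhatStep⇒≤B x (swap _ _ x) (ascent-step x i<j lt)

descent-step : ∀ {n} {i j : Fin n} (x : Perm n) → i F.< j →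
  x ⟨$⟩ʳ j F.< x ⟨$⟩ʳ i → BruhatStep (swap i j x) x
descent-step {i = i} {j} x i<j lt = i , j , i<j ,
  subst₂ (λ p q → x ⟨$⟩ʳ p F.< x ⟨$⟩ʳ q) (sym (transpose-left i j)) (sym (transpose-right i j)) lt ,
  λ k → sym (swap-involutive i j x k)

≤B-descent : ∀ {n} {i j : Fin n} (x : Perm n) → i F.< j →
  x ⟨$⟩ʳ j F.< x ⟨$⟩ʳ i → swap i j x ≤B x
≤B-descent x i<j lt = BruhatStep⇒≤B (swap _ _ x) x (descent-step x i<j lt)

-- Conjugation by the adjacent transposition moves the step at `p`, `q` to their images, which stay
-- in order unless the step is that transposition itself.
swap-step : ∀ {n} {i j : Fin n} → Adjacent i j → {a b : Perm n} → BruhatStep a b →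
  BruhatStep (swap i j a) (swap i j b) ⊎ (b ≈P swap i j a)
swap-step {i = i} {j} adj {a} {b} (p , q , p<q , lt , eq) with (p ≟ᶠ i) ×-dec (q ≟ᶠ j)
... | yes (refl , refl) = inj₂ eq
... | no ≢ij = inj₁ (s p , s q , transpose-adjacent-mono adj p<q ≢ij ,
    subst₂ (λ p q → a ⟨$⟩ʳ p F.< a ⟨$⟩ʳ q) (sym (ss p)) (sym (ss q)) lt , λ k →
    trans (eq (s k)) (cong (a ⟨$⟩ʳ_) (sym (trans (⟨$⟩ʳ-transpose (transposition i j) (s p) (s q) k)
      (cong₂ (λ p q → transpose p q (s k)) (ss p) (ss q))))))
  where
  s  = transpose i j
  ss = transpose-involutive i j

-- The lifting property, in a form which needs no case distinction on ascents and descents.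
swap-lift-source : ∀ {n} {i j : Fin n} → Adjacent i j → {a b : Perm n} → a ≤B b →
  (swap i j a ≤B swap i j b) ⊎ (swap i j a ≤B b)
swap-lift-source {i = i} {j} adj {a} {b} (≤B-refl e) =
  inj₁ (≤B-refl (swap-cong i j {a} {b} e))
swap-lift-source adj {b = b} (≤B-step {w = w} le st) with swap-lift-source adj le
... | inj₂ le' = inj₂ (≤B-step le' st)
... | inj₁ le' with swap-step adj {w} {b} st
...   | inj₁ st' = inj₁ (≤B-step le' st')
...   | inj₂ e   = inj₂ (≤B-respʳ le' (λ k → sym (e k)))

-- Induction on the chain: the last step either survives the multiplication or is the transposition
-- itself, and then `swap i j b` is `w`, already above `a`.
swap-lift-target : ∀ {n} {i j : Fin n} → Adjacent i j → {a b : Perm n} → a ≤B b →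
  (swap i j a ≤B swap i j b) ⊎ (a ≤B swap i j b)
swap-lift-target {i = i} {j} adj {a} {b} (≤B-refl e) =
  inj₁ (≤B-refl (swap-cong i j {a} {b} e))
swap-lift-target {i = i} {j} adj {a} {b} (≤B-step {w = w} le st) with swap-step adj {w} {b} st
... | inj₂ e = inj₂ (≤B-respʳ le λ k →
  trans (sym (swap-involutive i j w k)) (sym (swap-cong i j {b} {swap i j w} e k)))
... | inj₁ st' with swap-lift-target adj le
...   | inj₁ le' = inj₁ (≤B-step le' st')
...   | inj₂ le' = inj₂ (≤B-step le' st')

-- Multiplying values by w₀, that is x ↦ w₀ x.
rev : ∀ {n} → Perm n → Perm n
rev x = x ∘ₚ reverse

rev-involutive : ∀ {n} (x : Perm n) → rev (rev x) ≈P x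
rev-involutive x k = opposite-involutive (x ⟨$⟩ʳ k)

opposite-anti : ∀ {n} {i j : Fin n} → i F.< j → opposite j F.< opposite i
opposite-anti {i = i} {j} lt rewrite opposite-prop i | opposite-prop j =
  ∸-monoʳ-< (s≤s lt) (toℕ<n j)

-- Reversing values turns the ascent of each step into a descent, so the same transposition leads up
-- from `rev v` to `rev w`.
rev-anti : ∀ {n} {u v : Perm n} → u ≤B v → rev v ≤B rev u
rev-anti (≤B-refl e) = ≤B-refl λ k → cong opposite (sym (e k))
rev-anti {n} {u} {v} (≤B-step {w = w} le (i , j , i<j , lt , eq)) =
  ≤B-trans (BruhatStep⇒≤B (rev v) (rev w) step) (rev-anti le)
  where
  step : BruhatStep (rev v) (rev w)
  step = i , j , i<j ,
    subst₂ (λ p q → opposite p F.< opposite q)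
      (sym (trans (eq i) (cong (w ⟨$⟩ʳ_) (transpose-left i j))))
      (sym (trans (eq j) (cong (w ⟨$⟩ʳ_) (transpose-right i j))))
      (opposite-anti lt) ,
    λ k → cong opposite (sym (trans (eq _) (cong (w ⟨$⟩ʳ_) (transpose-involutive i j k))))

flip-cong : ∀ {n} {u v : Perm n} → u ≈P v → flip u ≈P flip v
flip-cong {u = u} {v} e k = ⟨$⟩ʳ-injective v
  (trans (sym (e (u ⟨$⟩ˡ k))) (trans (inverseʳ u) (sym (inverseʳ v))))

-- Inversion exchanges positions and values: a step at positions `i`, `j` becomes one at positions
-- `w ⟨$⟩ʳ i`, `w ⟨$⟩ʳ j` with values `i`, `j`.
flip-mono : ∀ {n} {u v : Perm n} → u ≤B v → flip u ≤B flip v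
flip-mono {u = u} {v} (≤B-refl e) = ≤B-refl (flip-cong {u = u} {v} e)
flip-mono {n} {u} {v} (≤B-step {w = w} le (i , j , i<j , lt , eq)) = ≤B-step (flip-mono le) step
  where
  step : BruhatStep (flip w) (flip v)
  step = w ⟨$⟩ʳ i , w ⟨$⟩ʳ j , lt ,
    subst₂ F._<_ (sym (inverseˡ w)) (sym (inverseˡ w)) i<j ,
    λ k → ⟨$⟩ʳ-injective v (trans (inverseʳ v) (sym (trans (eq _)
      (trans (⟨$⟩ʳ-transpose w i j _) (trans (cong (transpose _ _) (inverseʳ w))
        (transpose-involutive _ _ k))))))

-- A strictly decreasing weight

sum-change₁ : ∀ {n} {f g : Fin n → ℕ} (i : Fin n) → (∀ k → k ≢ i → f k ≡ g k) →
  sum f + g i ≡ sum g + f i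
sum-change₁ {suc n} {f} {g} i eq = begin
  sum f + g i                              ≡⟨ cong (_+ g i) (sum-remove {i = i} f) ⟩
  f i + sum (λ k → f (F.punchIn i k)) + g i ≡⟨ cong (λ r → f i + r + g i)
                                               (sum-cong-≗ λ k → eq _ (punchInᵢ≢i i k)) ⟩
  f i + sum (λ k → g (F.punchIn i k)) + g i ≡⟨ rotate (f i) _ (g i) ⟩
  g i + sum (λ k → g (F.punchIn i k)) + f i ≡⟨ cong (_+ f i) (sum-remove {i = i} g) ⟨
  sum g + f i                              ∎
  where
  open ≡-Reasoning
  rotate : ∀ a b c → a + b + c ≡ c + b + a
  rotate = solve-∀

sum-change₂ : ∀ {n} {f g : Fin n → ℕ} {i j : Fin n} → i ≢ j →
  (∀ k → k ≢ i → k ≢ j → f k ≡ g k) → sum f + (g i + g j) ≡ sum g + (f i + f j)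
sum-change₂ {n} {f} {g} {i} {j} i≢j eq = +-cancelʳ-≡ (sum h) _ _ (begin
  sum f + (g i + g j) + sum h   ≡⟨ regroup (sum f) (g i) (g j) (sum h) ⟩
  (sum f + g i) + (sum h + g j) ≡⟨ cong₂ _+_ fh hg ⟩
  (sum h + f i) + (sum g + f j) ≡⟨ regroup′ (sum h) (f i) (sum g) (f j) ⟩
  sum g + (f i + f j) + sum h   ∎)
  where
  open ≡-Reasoning
  -- `h` interpolates between `f` and `g`: it can differ from `f` only at `i` and from `g` only at
  -- `j`.
  h : Fin n → ℕ
  h k with k ≟ᶠ i
  ... | yes _ = g k
  ... | no  _ = f k
  hi : h i ≡ g i
  hi with i ≟ᶠ i
  ... | yes _ = refl
  ... | no ne = contradiction refl ne
  h-off : ∀ k → k ≢ i → h k ≡ f k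
  h-off k ne with k ≟ᶠ i
  ... | yes e = contradiction e ne
  ... | no  _ = refl
  h≡g : ∀ k → k ≢ j → h k ≡ g k
  h≡g k ne with k ≟ᶠ i
  ... | yes _  = refl
  ... | no ne' = eq k ne' ne
  fh : sum f + g i ≡ sum h + f i
  fh = trans (cong (sum f +_) (sym hi)) (sum-change₁ i λ k ne → sym (h-off k ne))
  hg : sum h + g j ≡ sum g + f j
  hg = trans (sum-change₁ j h≡g) (cong (sum g +_) (h-off j (i≢j ∘ sym)))
  regroup : ∀ a b c d → a + (b + c) + d ≡ (a + b) + (d + c)
  regroup = solve-∀
  regroup′ : ∀ a b c d → (a + b) + (c + d) ≡ c + (b + d) + a
  regroup′ = solve-∀

rearrangement : ∀ {a b c d} → a < b → c < d → a * d + b * c < a * c + b * d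
rearrangement {a} {b} {c} {d} a<b c<d = subst₂ (λ b d → a * d + b * c < a * c + b * d)
  (m+[n∸m]≡n (<⇒≤ a<b)) (m+[n∸m]≡n (<⇒≤ c<d))
  (subst (l <_) (sym (expand a c (b ∸ a) (d ∸ c)))
    (m<m+n l (*-mono-≤ (m<n⇒0<n∸m a<b) (m<n⇒0<n∸m c<d))))
  where
  -- The smaller side, with `b` and `d` written as `a` and `c` plus a difference; the two sides
  -- differ by the product of these positive differences.
  l = a * (c + (d ∸ c)) + (a + (b ∸ a)) * c
  expand : ∀ a c p q →
    a * c + (a + p) * (c + q) ≡ (a * (c + q) + (a + p) * c) + p * q
  expand = solve-∀

-- Its strict decrease along steps excludes cycles in the Bruhat order and makes climbing in it
-- terminate.
weight : ∀ {n} → Perm n → ℕ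
weight x = sum λ k → toℕ k * toℕ (x ⟨$⟩ʳ k)

weight-step : ∀ {n} {u w : Perm n} → BruhatStep u w → weight w < weight u
weight-step {n} {u} {w} (i , j , i<j , lt , eq) = +-cancelʳ-< _ _ _ (begin-strict
  weight w + (f w i + f w j) <⟨ +-monoʳ-< (weight w) smaller ⟩
  weight w + (f u i + f u j) ≡⟨ sum-change₂ {f = f w} {f u} i≢j unchanged ⟩
  weight u + (f w i + f w j) ∎)
  where
  open ≤-Reasoning
  f : Perm n → Fin n → ℕ
  f x k = toℕ k * toℕ (x ⟨$⟩ʳ k)
  i≢j : i ≢ j
  i≢j refl = <-irrefl refl i<j
  unchanged : ∀ k → k ≢ i → k ≢ j → f w k ≡ f u k
  unchanged k k≢i k≢j =
    cong (λ m → toℕ k * toℕ m) (trans (eq k) (cong (u ⟨$⟩ʳ_) (transpose-fixed k≢i k≢j)))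
  smaller : f w i + f w j < f u i + f u j
  smaller rewrite eq i | eq j | transpose-left i j | transpose-right i j = rearrangement i<j lt

weight-anti : ∀ {n} {u v : Perm n} → u ≤B v → weight v ≤ weight u
weight-anti (≤B-refl e) =
  ≤-reflexive (sym (sum-cong-≗ λ k → cong (λ m → toℕ k * toℕ m) (e k)))
weight-anti {v = v} (≤B-step {w = w} le st) =
  ≤-trans (<⇒≤ (weight-step {u = w} {v} st)) (weight-anti le)

-- Cosets: c assigns to each position the number of its block, so that x and y lie in the
-- same coset of the Young subgroup of c exactly when c ∘ x⁻¹ and c ∘ y⁻¹ agree.

Antitone : ∀ {n} → (Fin n → ℕ) → Set
Antitone c = ∀ {i j} → i F.< j → c j ≤ c i

SameCoset : ∀ {n} → (Fin n → ℕ) → Perm n → Perm n → Set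
SameCoset c x y = ∀ m → c (x ⟨$⟩ˡ m) ≡ c (y ⟨$⟩ˡ m)

MinInCoset MaxInCoset BlockIncreasing BlockDecreasing : ∀ {n} → (Fin n → ℕ) → Perm n → Set
MinInCoset c v = ∀ y → SameCoset c y v → v ≤B y
MaxInCoset c v = ∀ y → SameCoset c y v → y ≤B v
BlockIncreasing c v = ∀ {i j} → i F.< j → c i ≡ c j → v ⟨$⟩ʳ i F.< v ⟨$⟩ʳ j
BlockDecreasing c v = ∀ {i j} → i F.< j → c i ≡ c j → v ⟨$⟩ʳ j F.< v ⟨$⟩ʳ i

transpose-invariant : ∀ {n} (c : Fin n → ℕ) {i j} → c i ≡ c j → ∀ k → c (transpose i j k) ≡ c k
transpose-invariant c {i} {j} ci≡cj k = go (swapped i j k)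
  where
  go : ∀ {k r} → Swapped i j k r → c r ≡ c k
  go left        = sym ci≡cj
  go right       = ci≡cj
  go (fixed _ _) = refl

swap-sameCoset : ∀ {n} (c : Fin n → ℕ) {i j} → c i ≡ c j → ∀ x → SameCoset c (swap i j x) x
swap-sameCoset c ci≡cj x m = transpose-invariant c (sym ci≡cj) (x ⟨$⟩ˡ m)

≮⇒ascent : ∀ {n} (x : Perm n) {i j} → i F.< j →
  ¬ (x ⟨$⟩ʳ j F.< x ⟨$⟩ʳ i) → x ⟨$⟩ʳ i F.< x ⟨$⟩ʳ j
≮⇒ascent x i<j ¬lt =
  ≤∧≢⇒< (≮⇒≥ ¬lt) λ e → <-irrefl (cong toℕ (⟨$⟩ʳ-injective x (toℕ-injective e))) i<j

-- Undoing an inversion inside a block would give a strictly smaller element of the same coset.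
minInCoset⇒blockIncreasing : ∀ {n} (c : Fin n → ℕ) (v : Perm n) →
  MinInCoset c v → BlockIncreasing c v
minInCoset⇒blockIncreasing c v min {i} {j} i<j ci≡cj = ≮⇒ascent v i<j λ lt →
  <⇒≱ (weight-step {u = swap i j v} {v} (descent-step v i<j lt))
      (weight-anti (min (swap i j v) (swap-sameCoset c ci≡cj v)))

-- If `f i` were below `i`, then `f (f i)` would be below `f i`, against the induction hypothesis at
-- `f i`.
increasing⇒expansive : ∀ {n} (f : Fin n → Fin n) → (∀ {i j} → i F.< j → f i F.< f j) →
  ∀ i → toℕ i ≤ toℕ (f i)
increasing⇒expansive f mono i = go i (<-wellFounded (toℕ i))
  where
  go : ∀ i → Acc _<_ (toℕ i) → toℕ i ≤ toℕ (f i)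
  go i (acc rs) = ≮⇒≥ λ fi<i → <⇒≱ (mono fi<i) (go (f i) (rs fi<i))

-- Both `σ` and its inverse are increasing, hence expansive.
increasing⇒id : ∀ {n} (σ : Perm n) → (∀ {i j} → i F.< j → σ ⟨$⟩ʳ i F.< σ ⟨$⟩ʳ j) →
  ∀ i → σ ⟨$⟩ʳ i ≡ i
increasing⇒id σ mono i = toℕ-injective (≤-antisym
  (subst (λ k → toℕ (σ ⟨$⟩ʳ i) ≤ toℕ k) (inverseˡ σ)
    (increasing⇒expansive (σ ⟨$⟩ˡ_) mono⁻¹ (σ ⟨$⟩ʳ i)))
  (increasing⇒expansive (σ ⟨$⟩ʳ_) mono i))
  where
  mono⁻¹ : ∀ {i j} → i F.< j → σ ⟨$⟩ˡ i F.< σ ⟨$⟩ˡ j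
  mono⁻¹ i<j = ≮⇒ascent (flip σ) i<j λ lt →
    <-asym i<j (subst₂ F._<_ (inverseʳ σ) (inverseʳ σ) (mono lt))

-- As long as σ = u⁻¹ y is not the identity it has an inversion (i , j); i and j then lie in
-- the same block, and exchanging y(i) and y(j) increases y within its coset.
blockDecreasing⇒maxInCoset : ∀ {n} (c : Fin n → ℕ) → Antitone c → (u : Perm n) →
  BlockDecreasing c u → MaxInCoset c u
blockDecreasing⇒maxInCoset {n} c anti u decr y y~u = go y y~u (<-wellFounded (weight y))
  where
  go : ∀ y → SameCoset c y u → Acc _<_ (weight y) → y ≤B u
  go y y~u (acc rs) = decide (any? λ i → any? λ j →
      (toℕ i <? toℕ j) ×-dec (toℕ (σ ⟨$⟩ʳ j) <? toℕ (σ ⟨$⟩ʳ i)))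
    where
    σ = y ∘ₚ flip u
    uσ : ∀ i → u ⟨$⟩ʳ (σ ⟨$⟩ʳ i) ≡ y ⟨$⟩ʳ i
    uσ i = inverseʳ u
    cσ : ∀ i → c (σ ⟨$⟩ʳ i) ≡ c i
    cσ i = trans (sym (y~u (y ⟨$⟩ʳ i))) (cong c (inverseˡ y))
    decide : Dec (Σ (Fin n) λ i → Σ (Fin n) λ j →
      i F.< j × σ ⟨$⟩ʳ j F.< σ ⟨$⟩ʳ i) → y ≤B u
    decide (yes (i , j , i<j , lt)) =
      ≤B-trans (≤B-ascent y i<j ascent)
        (go (swap i j y) (λ m → trans (swap-sameCoset c ci≡cj y m) (y~u m))
          (rs (weight-step {u = y} {swap i j y} (ascent-step y i<j ascent))))
      where
      -- Antitonicity at `i`, `j` gives one inequality; at their images under `σ`, which come in the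
      -- opposite order and in unchanged blocks, it gives the other.
      ci≡cj : c i ≡ c j
      ci≡cj = ≤-antisym (subst₂ _≤_ (cσ i) (cσ j) (anti lt)) (anti i<j)
      ascent : y ⟨$⟩ʳ i F.< y ⟨$⟩ʳ j
      ascent = subst₂ F._<_ (uσ i) (uσ j) (decr lt (trans (cσ j) (trans (sym ci≡cj) (sym (cσ i)))))
    decide (no none) = ≤B-refl λ i → trans (sym (uσ i)) (cong (u ⟨$⟩ʳ_)
      (increasing⇒id σ (λ {i} {j} i<j → ≮⇒ascent σ i<j λ lt → none (i , j , i<j , lt)) i))

-- Left multiplication by w₀ permutes the cosets and reverses the order.
rev-maxInCoset : ∀ {n} (c : Fin n → ℕ) (v : Perm n) → MaxInCoset c v → MinInCoset c (rev v)
rev-maxInCoset c v max y y~v = ≤B-respʳ (rev-anti (max (rev y) λ m →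
  trans (y~v (opposite m)) (cong (λ k → c (v ⟨$⟩ˡ k)) (opposite-involutive m)))) (rev-involutive y)

-- From intervals with minimal top to intervals with maximal bottom

-- One inclusion between the sets of points spanning two polytopes; transfers in both directions
-- make the convex hulls equal.
record Transfers {n} (g h : Perm n → Fin n → ℕ) (u v u' v' : Perm n) : Set where
  constructor transfers
  field
    transfer : ∀ x → InInterval u v x →
      Σ (Perm n) λ x' → InInterval u' v' x' × (∀ m → g x m ≡ h x' m)

open Transfers

Transfers-refl : ∀ {n} {g : Perm n → Fin n → ℕ} {u v} → Transfers g g u v u v
Transfers-refl .transfer x x∈ = x , x∈ , λ _ → refl

Transfers-trans : ∀ {n} {g h k : Perm n → Fin n → ℕ} {u v u' v' u'' v''} →
  Transfers g h u v u' v' → Transfers h k u' v' u'' v'' → Transfers g k u v u'' v''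
Transfers-trans t t' .transfer x x∈ with transfer t x x∈
... | x' , x'∈ , e with transfer t' x' x'∈
...   | x'' , x''∈ , e' = x'' , x''∈ , λ m → trans (e m) (e' m)

cosetPoint : ∀ {n} → (Fin n → ℕ) → Perm n → Fin n → ℕ
cosetPoint c x m = c (x ⟨$⟩ˡ m)

module _ {n} (c : Fin n → ℕ) {i j : Fin n} (adj : Adjacent i j) (ci≡cj : c i ≡ c j)
  (u v : Perm n) (ascᵘ : u ⟨$⟩ʳ i F.< u ⟨$⟩ʳ j) (ascᵛ : v ⟨$⟩ʳ i F.< v ⟨$⟩ʳ j) where

  private
    g   = cosetPoint c
    s   = swap i j
    i<j = adjacent⇒< adj
    u≤us = ≤B-ascent u i<j ascᵘ
    v≤vs = ≤B-ascent v i<j ascᵛ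

    sameCoset : ∀ x m → g x m ≡ g (s x) m
    sameCoset x m = sym (swap-sameCoset c ci≡cj x m)

  -- The witness is the larger of `x` and `s x`, which share a coset; lifting bounds it below by
  -- `s u` and above by `s v`.
  swap-transfers : Transfers g g u v (s u) (s v)
  swap-transfers .transfer x (u≤x , x≤v) with toℕ (x ⟨$⟩ʳ j) <? toℕ (x ⟨$⟩ʳ i)
  ... | yes desc = x , (us≤x , ≤B-trans x≤v v≤vs) , λ _ → refl
    where
    us≤x : s u ≤B x
    us≤x with swap-lift-source adj u≤x
    ... | inj₁ us≤xs = ≤B-trans us≤xs (≤B-descent x i<j desc)
    ... | inj₂ le = le
  ... | no ¬desc = s x , (us≤xs , xs≤vs) , sameCoset x
    where
    us≤xs : s u ≤B s x
    us≤xs with swap-lift-source adj u≤x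
    ... | inj₁ le = le
    ... | inj₂ us≤x = ≤B-trans us≤x (≤B-ascent x i<j (≮⇒ascent x i<j ¬desc))
    xs≤vs : s x ≤B s v
    xs≤vs with swap-lift-source adj x≤v
    ... | inj₁ le = le
    ... | inj₂ xs≤v = ≤B-trans xs≤v v≤vs

  -- Dually, the witness is the smaller of `x` and `s x`.
  swap-transfers⁻¹ : Transfers g g (s u) (s v) u v
  swap-transfers⁻¹ .transfer x (us≤x , x≤vs) with toℕ (x ⟨$⟩ʳ j) <? toℕ (x ⟨$⟩ʳ i)
  ... | yes desc = s x , (u≤xs , xs≤v) , sameCoset x
    where
    u≤xs : u ≤B s x
    u≤xs with swap-lift-target adj us≤x
    ... | inj₁ le = ≤B-respˡ (λ k → sym (swap-involutive i j u k)) le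
    ... | inj₂ us≤xs = ≤B-trans u≤us us≤xs
    xs≤v : s x ≤B v
    xs≤v with swap-lift-target adj x≤vs
    ... | inj₁ le = ≤B-respʳ le (swap-involutive i j v)
    ... | inj₂ x≤vss =
      ≤B-trans (≤B-descent x i<j desc) (≤B-respʳ x≤vss (swap-involutive i j v))
  ... | no ¬desc = x , (≤B-trans u≤us us≤x , x≤v) , λ _ → refl
    where
    x≤v : x ≤B v
    x≤v with swap-lift-target adj x≤vs
    ... | inj₁ xs≤vss = ≤B-trans (≤B-ascent x i<j (≮⇒ascent x i<j ¬desc))
                          (≤B-respʳ xs≤vss (swap-involutive i j v))
    ... | inj₂ le = ≤B-respʳ le (swap-involutive i j v)

-- Blocks of an antitone `c` are intervals, so positions between `i` and `j` share their block and
-- the adjacent descents chain together.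
adjacent⇒blockDecreasing : ∀ {n} (c : Fin n → ℕ) → Antitone c → (u : Perm n) →
  (∀ {i j} → Adjacent i j → c i ≡ c j → u ⟨$⟩ʳ j F.< u ⟨$⟩ʳ i) → BlockDecreasing c u
adjacent⇒blockDecreasing {suc n} c anti u adjDecr {i} {j} =
  <-weakInduction (λ j → i F.< j → c i ≡ c j → u ⟨$⟩ʳ j F.< u ⟨$⟩ʳ i) (λ ()) step j
  where
  step : ∀ k → (i F.< inject₁ k → c i ≡ c (inject₁ k) → u ⟨$⟩ʳ inject₁ k F.< u ⟨$⟩ʳ i) →
    i F.< F.suc k → c i ≡ c (F.suc k) → u ⟨$⟩ʳ F.suc k F.< u ⟨$⟩ʳ i
  step k ih i<k+1 eq with i ≟ᶠ inject₁ k
  ... | yes refl = adjDecr (cong suc (sym (toℕ-inject₁ k))) eq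
  ... | no i≢k = <-trans (adjDecr adj (trans (sym eq') eq)) (ih i<k eq')
    where
    adj : Adjacent (inject₁ k) (F.suc k)
    adj = cong suc (sym (toℕ-inject₁ k))
    i<k : i F.< inject₁ k
    i<k = ≤∧≢⇒< (≤-pred (subst (suc (toℕ i) ≤_) adj i<k+1)) (i≢k ∘ toℕ-injective)
    eq' : c i ≡ c (inject₁ k)
    eq' = ≤-antisym (subst (_≤ c (inject₁ k)) (sym eq) (anti (adjacent⇒< adj))) (anti i<k)

-- The loop invariant: it forces every ascent of `u` inside a block to be an ascent of `v`.
BlockInversions⊆ : ∀ {n} → (Fin n → ℕ) → Perm n → Perm n → Set
BlockInversions⊆ c v u = ∀ {p q} → p F.< q → c p ≡ c q →
  v ⟨$⟩ʳ q F.< v ⟨$⟩ʳ p → u ⟨$⟩ʳ q F.< u ⟨$⟩ʳ p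

-- The pair `i`, `j` becomes an inversion of the new `u`; every other pair is carried in order to a
-- pair inside the same block.
swap-blockInversions⊆ : ∀ {n} (c : Fin n → ℕ) {i j} → Adjacent i j → c i ≡ c j → (u v : Perm n) →
  u ⟨$⟩ʳ i F.< u ⟨$⟩ʳ j → BlockInversions⊆ c v u → BlockInversions⊆ c (swap i j v) (swap i j u)
swap-blockInversions⊆ c {i} {j} adj ci≡cj u v asc inv {p} {q} p<q cp≡cq lt
  with (p ≟ᶠ i) ×-dec (q ≟ᶠ j)
... | yes (refl , refl) = subst₂ (λ a b → u ⟨$⟩ʳ a F.< u ⟨$⟩ʳ b)
        (sym (transpose-right i j)) (sym (transpose-left i j)) asc
... | no ≢ij = inv (transpose-adjacent-mono adj p<q ≢ij)
        (trans (transpose-invariant c ci≡cj p) (trans cp≡cq (sym (transpose-invariant c ci≡cj q)))) lt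

MaxBottom : ∀ {n} (c : Fin n → ℕ) (u v : Perm n) → Set
MaxBottom c u v = Σ _ λ u' → Σ _ λ v' → u' ≤B v' × MaxInCoset c u' ×
  Transfers (cosetPoint c) (cosetPoint c) u v u' v' ×
  Transfers (cosetPoint c) (cosetPoint c) u' v' u v

minTop⇒maxBottom : ∀ {n} (c : Fin n → ℕ) → Antitone c → (u v : Perm n) → u ≤B v →
  MinInCoset c v → MaxBottom c u v
minTop⇒maxBottom {n} c anti u v u≤v min =
  -- The invariant holds vacuously at first, since a minimal `v` has no inversions inside blocks.
  go u v u≤v (λ p<q cp≡cq lt → contradiction lt (<-asym (incr p<q cp≡cq)))
    (<-wellFounded (weight u))
  where
  incr : BlockIncreasing c v
  incr = minInCoset⇒blockIncreasing c v min
  go : ∀ u v → u ≤B v → BlockInversions⊆ c v u → Acc _<_ (weight u) → MaxBottom c u v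
  go u v u≤v inv (acc rs) = decide (any? λ i → any? λ j →
      (toℕ j ≟ suc (toℕ i)) ×-dec (c i ≟ c j) ×-dec (toℕ (u ⟨$⟩ʳ i) <? toℕ (u ⟨$⟩ʳ j)))
    where
    decide : Dec (Σ (Fin n) λ i → Σ (Fin n) λ j →
      Adjacent i j × c i ≡ c j × u ⟨$⟩ʳ i F.< u ⟨$⟩ʳ j) → MaxBottom c u v
    decide (yes (i , j , adj , ci≡cj , ascᵘ)) =
      shrink (go (swap i j u) (swap i j v) us≤vs (swap-blockInversions⊆ c adj ci≡cj u v ascᵘ inv)
        (rs (weight-step {u = u} {swap i j u} (ascent-step u i<j ascᵘ))))
      where
      i<j = adjacent⇒< adj
      ascᵛ : v ⟨$⟩ʳ i F.< v ⟨$⟩ʳ j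
      ascᵛ = ≮⇒ascent v i<j λ lt → <-asym ascᵘ (inv i<j ci≡cj lt)
      us≤vs : swap i j u ≤B swap i j v
      us≤vs with swap-lift-source adj u≤v
      ... | inj₁ le = le
      ... | inj₂ us≤v = ≤B-trans us≤v (≤B-ascent v i<j ascᵛ)
      shrink : MaxBottom c (swap i j u) (swap i j v) → MaxBottom c u v
      shrink (u' , v' , u'≤v' , max , to , from) = u' , v' , u'≤v' , max ,
        Transfers-trans (swap-transfers c adj ci≡cj u v ascᵘ ascᵛ) to ,
        Transfers-trans from (swap-transfers⁻¹ c adj ci≡cj u v ascᵘ ascᵛ)
    decide (no none) = u , v , u≤v ,
      blockDecreasing⇒maxInCoset c anti u (adjacent⇒blockDecreasing c anti u λ {i} {j} adj eq →
        ≤∧≢⇒< (≮⇒≥ λ lt → none (i , j , adj , eq , lt)) λ e →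
          <-irrefl (cong toℕ (sym (⟨$⟩ʳ-injective u (toℕ-injective e)))) (adjacent⇒< adj)) ,
      Transfers-refl , Transfers-refl

-- From intervals with maximal bottom to intervals with minimal top

InInterval-resp : ∀ {n} {u v u' v' x : Perm n} → u ≈P u' → v ≈P v' →
  InInterval u v x → InInterval u' v' x
InInterval-resp eᵘ eᵛ (u≤x , x≤v) = ≤B-respˡ (λ k → sym (eᵘ k)) u≤x , ≤B-respʳ x≤v eᵛ

Transfers-resp : ∀ {n} {g h : Perm n → Fin n → ℕ} {u v u' v' u'' v'' : Perm n} →
  u' ≈P u'' → v' ≈P v'' → Transfers g h u v u' v' → Transfers g h u v u'' v''
Transfers-resp eᵘ eᵛ t .transfer x x∈ with transfer t x x∈
... | x' , x'∈ , e = x' , InInterval-resp eᵘ eᵛ x'∈ , e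

rev-InInterval : ∀ {n} {u v x : Perm n} → InInterval u v x → InInterval (rev v) (rev u) (rev x)
rev-InInterval (u≤x , x≤v) = rev-anti x≤v , rev-anti u≤x

-- Value reversal permutes the coordinates of a coset point by `opposite`, so each equality is read
-- off at the opposite coordinate.
rev-transfers : ∀ {n} (c : Fin n → ℕ) {u v u' v' : Perm n} →
  Transfers (cosetPoint c) (cosetPoint c) u v u' v' →
  Transfers (cosetPoint c) (cosetPoint c) (rev v) (rev u) (rev v') (rev u')
rev-transfers c {u} {v} t .transfer x x∈
  with transfer t (rev x) (InInterval-resp (rev-involutive u) (rev-involutive v) (rev-InInterval x∈))
... | x' , x'∈ , e = rev x' , rev-InInterval x'∈ , λ m →
  trans (cong (cosetPoint c x) (sym (opposite-involutive m))) (e (opposite m))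

MinTop : ∀ {n} (c : Fin n → ℕ) (u v : Perm n) → Set
MinTop c u v = Σ _ λ u' → Σ _ λ v' → u' ≤B v' × MinInCoset c v' ×
  Transfers (cosetPoint c) (cosetPoint c) u v u' v' ×
  Transfers (cosetPoint c) (cosetPoint c) u' v' u v

maxBottom⇒minTop : ∀ {n} (c : Fin n → ℕ) → Antitone c → (u v : Perm n) → u ≤B v →
  MaxInCoset c u → MinTop c u v
maxBottom⇒minTop {n} c anti u v u≤v max
  with minTop⇒maxBottom c anti (rev v) (rev u) (rev-anti u≤v) (rev-maxInCoset c u max)
... | p , q , p≤q , maxᵖ , to , from = rev q , rev p , rev-anti p≤q , rev-maxInCoset c p maxᵖ ,
  transfers (λ x x∈ → transfer (rev-transfers c to) x (InInterval-resp (λ k → sym (rev-involutive u k))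
    (λ k → sym (rev-involutive v k)) x∈)) ,
  Transfers-resp (rev-involutive u) (rev-involutive v) (rev-transfers c from)

-- Convex hulls

-- Replacing a permutation requires the proof that it lies in the interval, so the new list is built
-- from the `All` certificate.
foldr-reduce : ∀ {A B C : Set} {P : A → Set} {f : A → C → C} {f' : B → C → C} {e : C}
  {h : ∀ {x} → P x → B} → (∀ {x} (px : P x) z → f x z ≡ f' (h px) z) →
  ∀ {xs} (pxs : All P xs) → foldr f e xs ≡ foldr f' e (reduce h pxs)
foldr-reduce eq []         = refl
foldr-reduce {f = f} eq (px ∷ pxs) = trans (cong (f _) (foldr-reduce eq pxs)) (eq px _)

reduce⁺ : ∀ {A B : Set} {P : A → Set} {Q : B → Set} {h : ∀ {x} → P x → B} →
  (∀ {x} (px : P x) → Q (h px)) → ∀ {xs} (pxs : All P xs) → All Q (reduce h pxs)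
reduce⁺ hQ []         = []
reduce⁺ hQ (px ∷ pxs) = hQ px ∷ reduce⁺ hQ pxs

-- The coefficients are kept and each permutation is replaced by its transfer.
InConv-transfer : ∀ {n} {g h : Perm n → Fin n → ℕ} {u v u' v' : Perm n} →
  Transfers g h u v u' v' → ∀ p → InConv (InInterval u v) g p → InConv (InInterval u' v') h p
InConv-transfer {h = h} t p (c , ok , total , coord) =
  reduce (λ { {l , x} (_ , x∈) → l , proj₁ (transfer t x x∈) }) ok ,
  reduce⁺ (λ { {l , x} (0≤l , x∈) → 0≤l , proj₁ (proj₂ (transfer t x x∈)) }) ok ,
  trans (sym (foldr-reduce (λ { {l , x} (_ , x∈) z → refl }) ok)) total ,
  λ j → trans (coord j) (foldr-reduce (λ { {l , x} (_ , x∈) z →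
    cong (λ a → l *ℚ ℕtoℚ a +ℚ z) (proj₂ (proj₂ (transfer t x x∈)) j) }) ok)

-- The two conventions

count-mono : ∀ {s} {P Q : Fin s → Bool} → (∀ k → P k ≡ true → Q k ≡ true) → count P ≤ count Q
count-mono {zero} imp = z≤n
count-mono {suc s} {P} {Q} imp with P F.zero | Q F.zero | imp F.zero
... | true  | true  | _ = s≤s (count-mono (imp ∘ F.suc))
... | true  | false | f = contradiction (f refl) λ ()
... | false | true  | _ = m≤n⇒m≤1+n (count-mono (imp ∘ F.suc))
... | false | false | _ = count-mono (imp ∘ F.suc)

count-cong : ∀ {s} {P Q : Fin s → Bool} → (∀ k → P k ≡ Q k) → count P ≡ count Q
count-cong eq = ≤-antisym (count-mono λ k → trans (sym (eq k))) (count-mono λ k → trans (eq k))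

-- twist n d is definitionally cosetPoint (block d).
block : ∀ {n s} → (Fin s → ℕ) → Fin n → ℕ
block d i = count λ k → does (toℕ i <? d k)

does-true⁻¹ : ∀ {A : Set} (a? : Dec A) → does a? ≡ true → A
does-true⁻¹ (yes a) _ = a

block-antitone : ∀ {n s} (d : Fin s → ℕ) → Antitone {n} (block d)
block-antitone d {i} {j} i<j = count-mono λ k j<d →
  dec-true (toℕ i <? d k) (<-trans i<j (does-true⁻¹ (toℕ j <? d k) j<d))

-- `opposite` sends the value `m` to `n ∸ suc m`, whose successor is `n ∸ m` because `m` is below
-- `n`; both thresholds thus say that `n ∸ m` is at most `d k`.
Φ-block : ∀ {s} n (d : Fin s → ℕ) (x : Perm n) j → Φ n d x j ≡ block d (opposite (x ⟨$⟩ʳ j))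
Φ-block n d x j = count-cong λ k → does-⇔ (mk⇔ (to k) (from k)) (n ≤? _) (_ <? d k)
  where
  m = toℕ (x ⟨$⟩ʳ j)
  to : ∀ k → n ≤ d k + m → toℕ (opposite (x ⟨$⟩ʳ j)) < d k
  to k le rewrite opposite-prop (x ⟨$⟩ʳ j) | sym (+-∸-assoc 1 (toℕ<n (x ⟨$⟩ʳ j))) =
    m≤n+o⇒m∸n≤o n m (subst (n ≤_) (+-comm (d k) m) le)
  from : ∀ k → toℕ (opposite (x ⟨$⟩ʳ j)) < d k → n ≤ d k + m
  from k lt rewrite opposite-prop (x ⟨$⟩ʳ j) | sym (+-∸-assoc 1 (toℕ<n (x ⟨$⟩ʳ j))) =
    subst (n ≤_) (+-comm m (d k)) (≤-trans (m≤n+m∸n n m) (+-monoʳ-≤ m lt))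

toTwisted fromTwisted : ∀ {n} → Perm n → Perm n
toTwisted x = flip (rev x)
fromTwisted y = rev (flip y)

toTwisted-anti : ∀ {n} {u v : Perm n} → u ≤B v → toTwisted v ≤B toTwisted u
toTwisted-anti {u = u} {v} le = flip-mono {u = rev v} {rev u} (rev-anti le)

fromTwisted-anti : ∀ {n} {u v : Perm n} → u ≤B v → fromTwisted v ≤B fromTwisted u
fromTwisted-anti {u = u} {v} le = rev-anti {u = flip u} {flip v} (flip-mono le)

fromTo : ∀ {n} (x : Perm n) → fromTwisted (toTwisted x) ≈P x
fromTo = rev-involutive

toFrom : ∀ {n} (y : Perm n) → toTwisted (fromTwisted y) ≈P y
toFrom y k = cong (y ⟨$⟩ʳ_) (opposite-involutive k)

-- The inverse of `toTwisted x` is `rev x` by definition.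
Φ-toTwisted : ∀ {s} n (d : Fin s → ℕ) (x : Perm n) j → Φ n d x j ≡ twist n d (toTwisted x) j
Φ-toTwisted = Φ-block

Φ-fromTwisted : ∀ {s} n (d : Fin s → ℕ) (y : Perm n) j → Φ n d (fromTwisted y) j ≡ twist n d y j
Φ-fromTwisted n d y j = trans (Φ-block n d (fromTwisted y) j)
  (cong (block d) (opposite-involutive (y ⟨$⟩ˡ j)))

toTwisted-transfers : ∀ {s} n (d : Fin s → ℕ) (u v : Perm n) →
  Transfers (Φ n d) (twist n d) u v (toTwisted v) (toTwisted u)
toTwisted-transfers n d u v .transfer x (u≤x , x≤v) =
  toTwisted x , (toTwisted-anti {u = x} {v} x≤v , toTwisted-anti {u = u} {x} u≤x) , Φ-toTwisted n d x

fromTwisted-transfers : ∀ {s} n (d : Fin s → ℕ) (u v : Perm n) →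
  Transfers (twist n d) (Φ n d) u v (fromTwisted v) (fromTwisted u)
fromTwisted-transfers n d u v .transfer x (u≤x , x≤v) =
  fromTwisted x , (fromTwisted-anti {u = x} {v} x≤v , fromTwisted-anti {u = u} {x} u≤x) ,
  λ m → sym (Φ-fromTwisted n d x m)

theorem4p6 : (n s : ℕ) → 1 ≤ n → 1 ≤ s → (d : Fin s → ℕ) → IsRankVector n d →
    ((u v : Perm n) → InBI n d u v →
    Σ (Perm n) λ u' → Σ (Perm n) λ v' →
    InBI~ n d u' v' × SamePolytope (InQ n d u v) (InQ~ n d u' v'))
    ×
    ((u v : Perm n) → InBI~ n d u v →
    Σ (Perm n) λ u' → Σ (Perm n) λ v' →
    InBI n d u' v' × SamePolytope (InQ~ n d u v) (InQ n d u' v'))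
theorem4p6 n s _ _ d _ = untwisted⇒twisted , twisted⇒untwisted
  where
  c : Fin n → ℕ
  c = block d

  φ τ : Perm n → Fin n → ℕ
  φ = Φ n d
  τ = twist n d

  samePolytope : ∀ {g h : Perm n → Fin n → ℕ} {u v u' v'} →
    Transfers g h u v u' v' → Transfers h g u' v' u v →
    SamePolytope (InConv (InInterval u v) g) (InConv (InInterval u' v') h)
  samePolytope {g} {h} to from p =
    mk⇔ (InConv-transfer to p) (InConv-transfer from p)

  untwisted⇒twisted : ∀ u v → InBI n d u v → Σ (Perm n) λ u' → Σ (Perm n) λ v' →
    InBI~ n d u' v' × SamePolytope (InQ n d u v) (InQ~ n d u' v')
  untwisted⇒twisted u v (u≤v , min) = finish
    (maxBottom⇒minTop c (block-antitone d) (toTwisted v) (toTwisted u)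
      (toTwisted-anti {u = u} {v} u≤v) max)
    where
    -- `toTwisted` carries the fibre of `Φ` through `v` to a coset and reverses the order, so
    -- minimality becomes maximality.
    max : MaxInCoset c (toTwisted v)
    max y y~v = ≤B-respˡ {v = toTwisted (fromTwisted y)} (λ k → sym (toFrom y k))
      (toTwisted-anti {u = v} {fromTwisted y} (min (fromTwisted y) λ j →
        trans (Φ-fromTwisted n d y j) (trans (y~v j) (sym (Φ-toTwisted n d v j)))))
    finish : MinTop c (toTwisted v) (toTwisted u) → Σ (Perm n) λ u' → Σ (Perm n) λ v' →
      InBI~ n d u' v' × SamePolytope (InQ n d u v) (InQ~ n d u' v')
    finish (u' , v' , u'≤v' , min' , to , from) = u' , v' , (u'≤v' , min') ,
      samePolytope
        (Transfers-trans (toTwisted-transfers n d u v) to)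
        -- The round trip returns to `u` and `v` only pointwise, hence the correction along `≈P`.
        (Transfers-trans from (Transfers-resp {u'' = u} {v} (fromTo u) (fromTo v)
          (fromTwisted-transfers n d (toTwisted v) (toTwisted u))))

  twisted⇒untwisted : ∀ u v → InBI~ n d u v → Σ (Perm n) λ u' → Σ (Perm n) λ v' →
    InBI n d u' v' × SamePolytope (InQ~ n d u v) (InQ n d u' v')
  twisted⇒untwisted u v (u≤v , min) =
    finish (minTop⇒maxBottom c (block-antitone d) u v u≤v min)
    where
    finish : MaxBottom c u v → Σ (Perm n) λ u' → Σ (Perm n) λ v' →
      InBI n d u' v' × SamePolytope (InQ~ n d u v) (InQ n d u' v')
    finish (u' , v' , u'≤v' , max , to , from) =
      fromTwisted v' , fromTwisted u' , (fromTwisted-anti {u = u'} {v'} u'≤v' , min') ,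
      samePolytope
        (Transfers-trans to (fromTwisted-transfers n d u' v'))
        (Transfers-trans (Transfers-resp {u'' = u'} {v'} (toFrom u') (toFrom v')
          (toTwisted-transfers n d (fromTwisted v') (fromTwisted u'))) from)
      where
      -- Conversely, a maximal coset element becomes minimal in its fibre of `Φ`.
      min' : ∀ y → (∀ j → φ y j ≡ φ (fromTwisted u') j) → fromTwisted u' ≤B y
      min' y eq = ≤B-respʳ {v = fromTwisted (toTwisted y)}
        (fromTwisted-anti {u = toTwisted y} {u'} (max (toTwisted y) λ j →
          trans (sym (Φ-toTwisted n d y j)) (trans (eq j) (Φ-fromTwisted n d u' j)))) (fromTo y)
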